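{- For every finite set $\Pi$ of path axioms, the tense logic $\mathsf{Kt\Pi}$ (the extension of the minimal tense logic $\mathsf{Kt}$ with all axioms in $\Pi$) has the Craig interpolation property: whenever $A\rightarrow B\in\mathsf{Kt\Pi}$, there is a tense formula $C$ such that $var(C)\subseteq var(A)\cap var(B)$, $A\rightarrow C\in\mathsf{Kt\Pi}$ and $C\rightarrow B\in\mathsf{Kt\Pi}$.
   Context: Tense formulae (in negation normal form) over a countable set of propositional variables $p$: $A ::= p \mid \overline{p} \mid \top \mid \bot \mid A\wedge A \mid A\vee A \mid \Box A \mid \Diamond A \mid \blacksquare A \mid \mathsf{P} A$, where $\mathsf{P}$ is the past diamond (dual to the past box $\blacksquare$). Negation $\overline{A}$ is defined recursively: the negation of $p$ is $\overline p$, of $\overline p$ is $p$, of $\top$ is $\bot$, of $\bot$ is $\top$; $\overline{B\wedge C}=\overline B\vee\overline C$, $\overline{B\vee C}=\overline B\wedge\overline C$, $\overline{\Box B}=\Diamond\overline B$, $\overline{\Diamond B}=\Box\overline B$, $\overline{\blacksquare B}=\mathsf{P}\overline B$, $\overline{\mathsf{P} B}=\blacksquare\overline B$. $A\rightarrow B$ abbreviates $\overline A\vee B$. $var(A)$ is the set of variables $p$ such that $p$ or $\overline p$ occurs in $A$. The minimal tense logic $\mathsf{Kt}$ is the smallest set of tense formulae containing all classical propositional tautologies (instances in the tense language) and all instances of $\overline A\vee\Box\mathsf{P} A$, $\overline A\vee\blacksquare\Diamond A$, $\Diamond(A\wedge\overline B)\vee\Diamond\overline A\vee\Box B$, $\mathsf{P}(A\wedge\overline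 B)\vee\mathsf{P}\overline A\vee\blacksquare B$, and closed under modus ponens and the rules: from $A$ infer $\Box A$; from $A$ infer $\blacksquare A$. A path axiom is a schema $\langle ?\rangle_1\cdots\langle ?\rangle_n A\rightarrow\langle ?\rangle A$ ($A$ an arbitrary tense formula), where $n\ge 0$ and $\langle ?\rangle_1,\dots,\langle ?\rangle_n,\langle ?\rangle\in\{\Diamond,\mathsf{P}\}$ are fixed. $\mathsf{Kt\Pi}$ is the smallest set of formulae containing the axioms of $\mathsf{Kt}$ and all instances of the path axioms in $\Pi$ and closed under the rules of $\mathsf{Kt}$. -}

module Defs where

open import Data.Bool.Base as Bool using (Bool; true; false; not)
open import Data.List.Base using (List; []; _∷_; foldr)
open import Data.List.Membership.Propositional using () renaming (_∈_ to _∈ˡ_)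
open import Data.Nat.Base using (ℕ)
open import Level using (0ℓ)
open import Relation.Binary.PropositionalEquality.Core using (_≡_)
open import Relation.Unary using (Pred; ∅; ｛_｝; _∪_)

Var : Set
Var = ℕ

infix  9 ∼_
infix  8 □_ ◇_ ■_ P_ ⟨_⟩_
infixr 7 _∧_
infixr 6 _∨_
infixr 5 _⇒_

data Formula : Set where
  pos neg         : Var → Formula
  ⊤ ⊥             : Formula
  _∧_ _∨_         : Formula → Formula → Formula
  □_ ◇_ ■_ P_     : Formula → Formula

∼_ : Formula → Formula
∼ (pos p) = neg p
∼ (neg p) = pos p
∼ ⊤       = ⊥
∼ ⊥       = ⊤
∼ (A ∧ B) = ∼ A ∨ ∼ B
∼ (A ∨ B) = ∼ A ∧ ∼ B
∼ (□ A)   = ◇ (∼ A)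
∼ (◇ A)   = □ (∼ A)
∼ (■ A)   = P (∼ A)
∼ (P A)   = ■ (∼ A)

_⇒_ : Formula → Formula → Formula
A ⇒ B = ∼ A ∨ B

var : Formula → Pred Var 0ℓ
var (pos p) = ｛ p ｝
var (neg p) = ｛ p ｝
var ⊤       = ∅
var ⊥       = ∅
var (A ∧ B) = var A ∪ var B
var (A ∨ B) = var A ∪ var B
var (□ A)   = var A
var (◇ A)   = var A
var (■ A)   = var A
var (P A)   = var A

-- Classical propositional formulae, likewise in negation normal form.
data PropFormula : Set where
  posᵖ negᵖ   : Var → PropFormula
  ⊤ᵖ ⊥ᵖ       : PropFormula
  _∧ᵖ_ _∨ᵖ_   : PropFormula → PropFormula → PropFormula

eval : (Var → Bool) → PropFormula → Bool
eval v (posᵖ p) = v p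
eval v (negᵖ p) = not (v p)
eval v ⊤ᵖ       = true
eval v ⊥ᵖ       = false
eval v (φ ∧ᵖ ψ) = eval v φ Bool.∧ eval v ψ
eval v (φ ∨ᵖ ψ) = eval v φ Bool.∨ eval v ψ

Tautology : PropFormula → Set
Tautology φ = ∀ v → eval v φ ≡ true

subst : (Var → Formula) → PropFormula → Formula
subst σ (posᵖ p) = σ p
subst σ (negᵖ p) = ∼ (σ p)
subst σ ⊤ᵖ       = ⊤
subst σ ⊥ᵖ       = ⊥
subst σ (φ ∧ᵖ ψ) = subst σ φ ∧ subst σ ψ
subst σ (φ ∨ᵖ ψ) = subst σ φ ∨ subst σ ψ

data Diamond : Set where
  future past : Diamond

⟨_⟩_ : Diamond → Formula → Formula
⟨ future ⟩ A = ◇ A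
⟨ past   ⟩ A = P A

-- path (d₁ ∷ … ∷ dₙ ∷ []) d  is the schema  ⟨d₁⟩ … ⟨dₙ⟩ A → ⟨d⟩ A.
record PathAxiom : Set where
  constructor path
  field
    antecedent : List Diamond
    consequent : Diamond

instantiate : PathAxiom → Formula → Formula
instantiate (path ds d) A = foldr ⟨_⟩_ A ds ⇒ ⟨ d ⟩ A

-- The theorems of KtΠ; a finite set Π of path axioms is given by a list.
data Kt⟨_⟩ (Π : List PathAxiom) : Pred Formula 0ℓ where
  taut   : ∀ φ (σ : Var → Formula) → Tautology φ → Kt⟨ Π ⟩ (subst σ φ)
  conv-□ : ∀ A → Kt⟨ Π ⟩ (∼ A ∨ □ P A)
  conv-■ : ∀ A → Kt⟨ Π ⟩ (∼ A ∨ ■ ◇ A)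
  dist-□ : ∀ A B → Kt⟨ Π ⟩ (◇ (A ∧ ∼ B) ∨ ◇ (∼ A) ∨ □ B)
  dist-■ : ∀ A B → Kt⟨ Π ⟩ (P (A ∧ ∼ B) ∨ P (∼ A) ∨ ■ B)
  pathAx : ∀ {π} → π ∈ˡ Π → ∀ A → Kt⟨ Π ⟩ (instantiate π A)
  mp     : ∀ {A B} → Kt⟨ Π ⟩ A → Kt⟨ Π ⟩ (A ⇒ B) → Kt⟨ Π ⟩ B
  nec-□  : ∀ {A} → Kt⟨ Π ⟩ A → Kt⟨ Π ⟩ (□ A)
  nec-■  : ∀ {A} → Kt⟨ Π ⟩ A → Kt⟨ Π ⟩ (■ A)

Kt : Pred Formula 0ℓ
Kt = Kt⟨ [] ⟩

{-# OPTIONS --safe #-}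
module Submission where

-- Cut-free tree sequents, in which ⟨ d ⟩ A at x may be propagated along every d-step of the
-- closure of the tree under converse and Π, are complete for KtΠ: they carry a forcing model in
-- which every theorem of KtΠ is forced, and a forced formula that occurs in a sequent makes that
-- sequent provable.  No cut elimination is needed.  By induction on a cut-free proof, every
-- splitting Γ | Δ of a sequent has an interpolant, a conjunction of tree sequents.  Taking
-- transversals of the negated clauses interchanges Γ and Δ, so only rules acting on Γ need
-- attention; in the box rule, a clause N at the new leaf below x becomes [ d ] ⋁ N at x.

open import Defs
open import Data.Bool.Base as Bool using (Bool; true; false; not; if_then_else_)
open import Data.Bool.Properties using (∧-conicalˡ; ∧-conicalʳ)
open import Data.Fin.Base using (Fin; zero; suc)
open import Data.List.Base using (List; []; _∷_; _++_; foldr; map; cartesianProductWith)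
open import Data.List.Membership.Propositional using () renaming (_∈_ to _∈ˡ_)
open import Data.List.Membership.Propositional.Properties
  using (∈-++⁺ˡ; ∈-++⁺ʳ; ∈-++⁻; ∈-map⁺; ∈-map⁻; ∈-cartesianProductWith⁺; ∈-cartesianProductWith⁻)
open import Data.List.Relation.Unary.Any using (here; there)
open import Data.List.Relation.Binary.Subset.Propositional using () renaming (_⊆_ to _⊆ˡ_)
open import Data.List.Relation.Binary.Subset.Propositional.Properties using (xs⊆xs++ys; xs⊆ys++xs)
open import Data.Nat.Base using (ℕ; zero; suc; _⊓_)
open import Data.Nat.Properties using (_≟_)
open import Data.Product.Base using (∃-syntax; _×_; _,_; proj₁; proj₂; map₁; Σ-syntax)
open import Data.Sum.Base as Sum using (_⊎_; inj₁; inj₂; [_,_]′)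
open import Data.Unit.Base using (tt) renaming (⊤ to Unit)
open import Function.Base using (_∘_; id)
open import Level using (0ℓ)
open import Relation.Binary.PropositionalEquality as ≡ using (_≡_; refl; sym; trans; cong; cong₂)
open import Relation.Nullary using (yes; no)
open import Relation.Unary using (Pred; _∈_; _⊆_; _∩_)

-- Negation, modalities by direction, and finite connectives

∼-involutive : ∀ A → ∼ ∼ A ≡ A
∼-involutive (pos p) = refl
∼-involutive (neg p) = refl
∼-involutive ⊤       = refl
∼-involutive ⊥       = refl
∼-involutive (A ∧ B) = cong₂ _∧_ (∼-involutive A) (∼-involutive B)
∼-involutive (A ∨ B) = cong₂ _∨_ (∼-involutive A) (∼-involutive B)
∼-involutive (□ A)   = cong □_ (∼-involutive A)
∼-involutive (◇ A)   = cong ◇_ (∼-involutive A)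
∼-involutive (■ A)   = cong ■_ (∼-involutive A)
∼-involutive (P A)   = cong P_ (∼-involutive A)

var-∼ : ∀ A → var (∼ A) ⊆ var A
var-∼ (pos p) v        = v
var-∼ (neg p) v        = v
var-∼ ⊤       v        = v
var-∼ ⊥       v        = v
var-∼ (A ∧ B) (inj₁ v) = inj₁ (var-∼ A v)
var-∼ (A ∧ B) (inj₂ v) = inj₂ (var-∼ B v)
var-∼ (A ∨ B) (inj₁ v) = inj₁ (var-∼ A v)
var-∼ (A ∨ B) (inj₂ v) = inj₂ (var-∼ B v)
var-∼ (□ A)   v        = var-∼ A v
var-∼ (◇ A)   v        = var-∼ A v
var-∼ (■ A)   v        = var-∼ A v
var-∼ (P A)   v        = var-∼ A v

infix 8 [_]_
infix 9 _°

[_]_ : Diamond → Formula → Formula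
[ future ] A = □ A
[ past   ] A = ■ A

_° : Diamond → Diamond
future ° = past
past   ° = future

∼-box : ∀ d A → ∼ ([ d ] A) ≡ ⟨ d ⟩ (∼ A)
∼-box future A = refl
∼-box past   A = refl

var-box : ∀ d A → var ([ d ] A) ⊆ var A
var-box future A v = v
var-box past   A v = v

var-box⁻ : ∀ d A → var A ⊆ var ([ d ] A)
var-box⁻ future A v = v
var-box⁻ past   A v = v

var-diamond⁻ : ∀ d A → var A ⊆ var (⟨ d ⟩ A)
var-diamond⁻ future A v = v
var-diamond⁻ past   A v = v

⋁ : List Formula → Formula
⋁ = foldr _∨_ ⊥

⋀ : List Formula → Formula
⋀ = foldr _∧_ ⊤

var-⋁ : ∀ {Z : Pred Var 0ℓ} N → (∀ {A} → A ∈ˡ N → var A ⊆ Z) → var (⋁ N) ⊆ Z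
var-⋁ (A ∷ N) N⊆Z (inj₁ v) = N⊆Z (here refl) v
var-⋁ (A ∷ N) N⊆Z (inj₂ v) = var-⋁ N (N⊆Z ∘ there) v

var-⋀ : ∀ {Z : Pred Var 0ℓ} N → (∀ {A} → A ∈ˡ N → var A ⊆ Z) → var (⋀ N) ⊆ Z
var-⋀ (A ∷ N) N⊆Z (inj₁ v) = N⊆Z (here refl) v
var-⋀ (A ∷ N) N⊆Z (inj₂ v) = var-⋀ N (N⊆Z ∘ there) v

-- Propositional schemata in three variables

pattern p₀ = posᵖ 0
pattern p₁ = posᵖ 1
pattern p₂ = posᵖ 2
pattern n₀ = negᵖ 0
pattern n₁ = negᵖ 1
pattern n₂ = negᵖ 2

assign : ∀ {ℓ} {X : Set ℓ} → X → X → X → Var → X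
assign a b c 0             = a
assign a b c 1             = b
assign a b c (suc (suc _)) = c

assign-⊓ : ∀ {ℓ} {X : Set ℓ} (f : Var → X) p → assign (f 0) (f 1) (f 2) p ≡ f (p ⊓ 2)
assign-⊓ f 0             = refl
assign-⊓ f 1             = refl
assign-⊓ f (suc (suc zero))    = refl
assign-⊓ f (suc (suc (suc _))) = refl

-- Identifying all variables from 2 on makes eight rows a complete truth table.
clamp : PropFormula → PropFormula
clamp (posᵖ p) = posᵖ (p ⊓ 2)
clamp (negᵖ p) = negᵖ (p ⊓ 2)
clamp ⊤ᵖ       = ⊤ᵖ
clamp ⊥ᵖ       = ⊥ᵖ
clamp (φ ∧ᵖ ψ) = clamp φ ∧ᵖ clamp ψ
clamp (φ ∨ᵖ ψ) = clamp φ ∨ᵖ clamp ψ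

eval-clamp : ∀ v φ → eval v (clamp φ) ≡ eval (assign (v 0) (v 1) (v 2)) φ
eval-clamp v (posᵖ p) = sym (assign-⊓ v p)
eval-clamp v (negᵖ p) = cong not (sym (assign-⊓ v p))
eval-clamp v ⊤ᵖ       = refl
eval-clamp v ⊥ᵖ       = refl
eval-clamp v (φ ∧ᵖ ψ) = cong₂ Bool._∧_ (eval-clamp v φ) (eval-clamp v ψ)
eval-clamp v (φ ∨ᵖ ψ) = cong₂ Bool._∨_ (eval-clamp v φ) (eval-clamp v ψ)

assign-clamped : ∀ A B C p → assign {X = Formula} A B C (p ⊓ 2) ≡ assign A B C p
assign-clamped A B C 0                   = refl
assign-clamped A B C 1                   = refl
assign-clamped A B C (suc (suc zero))    = refl
assign-clamped A B C (suc (suc (suc _))) = refl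

subst-clamp : ∀ A B C φ → subst (assign A B C) (clamp φ) ≡ subst (assign A B C) φ
subst-clamp A B C (posᵖ p) = assign-clamped A B C p
subst-clamp A B C (negᵖ p) = cong ∼_ (assign-clamped A B C p)
subst-clamp A B C ⊤ᵖ       = refl
subst-clamp A B C ⊥ᵖ       = refl
subst-clamp A B C (φ ∧ᵖ ψ) = cong₂ _∧_ (subst-clamp A B C φ) (subst-clamp A B C ψ)
subst-clamp A B C (φ ∨ᵖ ψ) = cong₂ _∨_ (subst-clamp A B C φ) (subst-clamp A B C ψ)

both : (Bool → Bool) → Bool
both f = f true Bool.∧ f false

both-sound : ∀ f → both f ≡ true → ∀ b → f b ≡ true
both-sound f eq true  = ∧-conicalˡ (f true) (f false) eq
both-sound f eq false = ∧-conicalʳ (f true) (f false) eq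

-- The eight rows are evaluated by normalisation, so each propositional step of the Hilbert
-- derivations is certified by `refl`.
truthTable : PropFormula → Bool
truthTable φ = both λ a → both λ b → both λ c → eval (assign a b c) φ

truthTable-sound : ∀ φ → truthTable φ ≡ true → Tautology (clamp φ)
truthTable-sound φ eq v = trans (eval-clamp v φ)
  (both-sound (λ c → eval (assign (v 0) (v 1) c) φ)
    (both-sound (λ b → both λ c → eval (assign (v 0) b c) φ)
      (both-sound (λ a → both λ b → both λ c → eval (assign a b c) φ) eq (v 0)) (v 1)) (v 2))

infix 21 ∼ᵖ_

∼ᵖ_ : PropFormula → PropFormula
∼ᵖ (posᵖ p) = negᵖ p
∼ᵖ (negᵖ p) = posᵖ p
∼ᵖ ⊤ᵖ       = ⊥ᵖ
∼ᵖ ⊥ᵖ       = ⊤ᵖ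
∼ᵖ (φ ∧ᵖ ψ) = ∼ᵖ φ ∨ᵖ ∼ᵖ ψ
∼ᵖ (φ ∨ᵖ ψ) = ∼ᵖ φ ∧ᵖ ∼ᵖ ψ

subst-∼ : ∀ σ φ → subst σ (∼ᵖ φ) ≡ ∼ subst σ φ
subst-∼ σ (posᵖ p) = refl
subst-∼ σ (negᵖ p) = sym (∼-involutive (σ p))
subst-∼ σ ⊤ᵖ       = refl
subst-∼ σ ⊥ᵖ       = refl
subst-∼ σ (φ ∧ᵖ ψ) = cong₂ _∨_ (subst-∼ σ φ) (subst-∼ σ ψ)
subst-∼ σ (φ ∨ᵖ ψ) = cong₂ _∧_ (subst-∼ σ φ) (subst-∼ σ ψ)

-- Labelled trees and sequents

-- In grow T x d the new leaf is 0 and is a d-successor of x; old nodes are shifted by suc.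
data Tree : ℕ → Set where
  root : Tree 1
  grow : ∀ {n} → Tree n → Fin n → Diamond → Tree (suc n)

Sequent : ℕ → Set
Sequent n = List (Fin n × Formula)

shift : ∀ {n} → Sequent n → Sequent (suc n)
shift = map (map₁ suc)

∈-shift⁺ : ∀ {n} {Γ : Sequent n} {x A} → (x , A) ∈ˡ Γ → (suc x , A) ∈ˡ shift Γ
∈-shift⁺ = ∈-map⁺ (map₁ suc)

∈-shift⁻ : ∀ {n} {Γ : Sequent n} {x A} → (x , A) ∈ˡ shift Γ → ∃[ y ] (x ≡ suc y) × ((y , A) ∈ˡ Γ)
∈-shift⁻ A∈ with ∈-map⁻ (map₁ suc) A∈
... | (y , _) , A∈Γ , refl = y , refl , A∈Γ

leaf : ∀ {n} → Sequent (suc n) → List Formula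
leaf []                = []
leaf ((zero  , A) ∷ Γ) = A ∷ leaf Γ
leaf ((suc x , A) ∷ Γ) = leaf Γ

trunk : ∀ {n} → Sequent (suc n) → Sequent n
trunk []                = []
trunk ((zero  , A) ∷ Γ) = trunk Γ
trunk ((suc x , A) ∷ Γ) = (x , A) ∷ trunk Γ

∈-leaf⁺ : ∀ {n A} (Γ : Sequent (suc n)) → (zero , A) ∈ˡ Γ → A ∈ˡ leaf Γ
∈-leaf⁺ (_           ∷ Γ) (here refl) = here refl
∈-leaf⁺ ((zero  , _) ∷ Γ) (there A∈)  = there (∈-leaf⁺ Γ A∈)
∈-leaf⁺ ((suc x , _) ∷ Γ) (there A∈)  = ∈-leaf⁺ Γ A∈

∈-leaf⁻ : ∀ {n A} (Γ : Sequent (suc n)) → A ∈ˡ leaf Γ → (zero , A) ∈ˡ Γ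
∈-leaf⁻ ((zero  , _) ∷ Γ) (here refl) = here refl
∈-leaf⁻ ((zero  , _) ∷ Γ) (there A∈)  = there (∈-leaf⁻ Γ A∈)
∈-leaf⁻ ((suc x , _) ∷ Γ) A∈          = there (∈-leaf⁻ Γ A∈)

∈-trunk⁺ : ∀ {n x A} (Γ : Sequent (suc n)) → (suc x , A) ∈ˡ Γ → (x , A) ∈ˡ trunk Γ
∈-trunk⁺ (_           ∷ Γ) (here refl) = here refl
∈-trunk⁺ ((zero  , _) ∷ Γ) (there A∈)  = ∈-trunk⁺ Γ A∈
∈-trunk⁺ ((suc x , _) ∷ Γ) (there A∈)  = there (∈-trunk⁺ Γ A∈)

∈-trunk⁻ : ∀ {n x A} (Γ : Sequent (suc n)) → (x , A) ∈ˡ trunk Γ → (suc x , A) ∈ˡ Γ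
∈-trunk⁻ ((zero  , _) ∷ Γ) A∈          = there (∈-trunk⁻ Γ A∈)
∈-trunk⁻ ((suc x , _) ∷ Γ) (here refl) = here refl
∈-trunk⁻ ((suc x , _) ∷ Γ) (there A∈)  = there (∈-trunk⁻ Γ A∈)

leaf-shift : ∀ {n} (Γ : Sequent n) → leaf (shift Γ) ≡ []
leaf-shift []      = refl
leaf-shift (_ ∷ Γ) = leaf-shift Γ

trunk-shift : ∀ {n} (Γ : Sequent n) → trunk (shift Γ) ≡ Γ
trunk-shift []            = refl
trunk-shift ((x , A) ∷ Γ) = cong ((x , A) ∷_) (trunk-shift Γ)

-- A shifted context has nothing at the new leaf. Together with `trunk-++-shift` this carries
-- contexts through the box rule for interpolants.
leaf-++-shift : ∀ {n} (Γ : Sequent (suc n)) (Δ : Sequent n) → leaf (Γ ++ shift Δ) ≡ leaf Γ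
leaf-++-shift []                Δ = leaf-shift Δ
leaf-++-shift ((zero  , A) ∷ Γ) Δ = cong (A ∷_) (leaf-++-shift Γ Δ)
leaf-++-shift ((suc x , A) ∷ Γ) Δ = leaf-++-shift Γ Δ

trunk-++-shift : ∀ {n} (Γ : Sequent (suc n)) (Δ : Sequent n) → trunk (Γ ++ shift Δ) ≡ trunk Γ ++ Δ
trunk-++-shift []                Δ = trunk-shift Δ
trunk-++-shift ((zero  , A) ∷ Γ) Δ = trunk-++-shift Γ Δ
trunk-++-shift ((suc x , A) ∷ Γ) Δ = cong ((x , A) ∷_) (trunk-++-shift Γ Δ)

++-⊆-swap : ∀ {X : Set} (xs ys : List X) → xs ++ ys ⊆ˡ ys ++ xs
++-⊆-swap xs ys = [ ∈-++⁺ʳ ys , ∈-++⁺ˡ ]′ ∘ ∈-++⁻ xs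

∷-⊆-swap : ∀ {X : Set} {x y : X} {xs} → x ∷ y ∷ xs ⊆ˡ y ∷ x ∷ xs
∷-⊆-swap (here eq)         = there (here eq)
∷-⊆-swap (there (here eq)) = here eq
∷-⊆-swap (there (there i)) = there (there i)

∷-⊆-mono : ∀ {X : Set} {x : X} {xs ys} → xs ⊆ˡ ys → x ∷ xs ⊆ˡ x ∷ ys
∷-⊆-mono xs⊆ys (here eq) = here eq
∷-⊆-mono xs⊆ys (there i) = there (xs⊆ys i)

-- Edges run from parent to child only; the way back is supplied by `converse` in `Reach`.
data Edge : ∀ {n} → Tree n → Diamond → Fin n → Fin n → Set where
  here  : ∀ {n} {T : Tree n} {x d} → Edge (grow T x d) d (suc x) zero
  there : ∀ {n} {T : Tree n} {x y z d e} → Edge T d x z → Edge (grow T y e) d (suc x) (suc z)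

data Path {X : Set} (R : Diamond → X → X → Set) : List Diamond → X → X → Set where
  []  : ∀ {x} → Path R [] x x
  _∷_ : ∀ {d ds x y z} → R d x y → Path R ds y z → Path R (d ∷ ds) x z

-- Propagation and the cut-free tree calculus

module Calculus (Π : List PathAxiom) where

  -- The least tense frame relation that contains the tree and satisfies Π.
  data Reach {n} (T : Tree n) : Diamond → Fin n → Fin n → Set where
    edge     : ∀ {d x y} → Edge T d x y → Reach T d x y
    converse : ∀ {d x y} → Reach T d x y → Reach T (d °) y x
    closed   : ∀ {ds d x y} → path ds d ∈ˡ Π → Path (Reach T) ds x y → Reach T d x y

  -- Principal formulas are kept in the premises and found by membership, which builds in exchange
  -- and contraction.
  data Cutfree : ∀ {n} → Tree n → Sequent n → Set where
    atoms        : ∀ {n} {T : Tree n} {Γ x p} →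
                   (x , pos p) ∈ˡ Γ → (x , neg p) ∈ˡ Γ → Cutfree T Γ
    ⊤-rule       : ∀ {n} {T : Tree n} {Γ x} → (x , ⊤) ∈ˡ Γ → Cutfree T Γ
    ∧-rule       : ∀ {n} {T : Tree n} {Γ x A B} → (x , A ∧ B) ∈ˡ Γ →
                   Cutfree T ((x , A) ∷ Γ) → Cutfree T ((x , B) ∷ Γ) → Cutfree T Γ
    ∨-rule       : ∀ {n} {T : Tree n} {Γ x A B} → (x , A ∨ B) ∈ˡ Γ →
                   Cutfree T ((x , A) ∷ (x , B) ∷ Γ) → Cutfree T Γ
    box-rule     : ∀ {n} {T : Tree n} {Γ x A} d → (x , [ d ] A) ∈ˡ Γ →
                   Cutfree (grow T x d) ((zero , A) ∷ shift Γ) → Cutfree T Γ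
    diamond-rule : ∀ {n} {T : Tree n} {Γ x y A} d → (x , ⟨ d ⟩ A) ∈ˡ Γ →
                   Reach T d x y → Cutfree T ((y , A) ∷ Γ) → Cutfree T Γ

  module _ {m n} {S : Tree m} {T : Tree n} (f : Fin m → Fin n)
           (edges : ∀ {d x y} → Edge S d x y → Reach T d (f x) (f y)) where
    reach-map : ∀ {d x y} → Reach S d x y → Reach T d (f x) (f y)
    path-map  : ∀ {ds x y} → Path (Reach S) ds x y → Path (Reach T) ds (f x) (f y)

    reach-map (edge e)       = edges e
    reach-map (converse r)   = converse (reach-map r)
    reach-map (closed ax rs) = closed ax (path-map rs)

    path-map []       = []
    path-map (r ∷ rs) = reach-map r ∷ path-map rs

  -- Cut-free completeness

  -- Classical forcing over the tree sequents: Neg X says that X makes every extension provable,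
  -- so cut-free provability plays the role of falsity.
  record World : Set where
    constructor world
    field
      {size}  : ℕ
      tree    : Tree size
      sequent : Sequent size

    Node : Set
    Node = Fin size
  open World

  Provable : World → Set
  Provable W = Cutfree (tree W) (sequent W)

  -- Extensions carry a map of nodes because growing the tree renames them; worlds thus form a
  -- category rather than an order.
  record _⟶_ (V W : World) : Set where
    field
      to       : Node V → Node W
      edges    : ∀ {d x y} → Edge (tree V) d x y → Reach (tree W) d (to x) (to y)
      formulas : ∀ {x A} → (x , A) ∈ˡ sequent V → (to x , A) ∈ˡ sequent W

    reaches : ∀ {d x y} → Reach (tree V) d x y → Reach (tree W) d (to x) (to y)
    reaches = reach-map to edges
  open _⟶_

  idʷ : ∀ {W} → W ⟶ W
  idʷ = record { to = id ; edges = edge ; formulas = id }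

  infixr 9 _∘ʷ_
  _∘ʷ_ : ∀ {U V W} → V ⟶ W → U ⟶ V → U ⟶ W
  g ∘ʷ f = record
    { to       = to g ∘ to f
    ; edges    = reaches g ∘ edges f
    ; formulas = formulas g ∘ formulas f
    }

  infixr 5 _▸_
  _▸_ : ∀ W → Sequent (size W) → World
  world T Γ ▸ Δ = world T (Δ ++ Γ)

  sprout : (W : World) → Node W → Diamond → World
  sprout (world T Γ) x d = world (grow T x d) (shift Γ)

  enlarge : ∀ {W} Δ → W ⟶ (W ▸ Δ)
  enlarge Δ = record { to = id ; edges = edge ; formulas = ∈-++⁺ʳ Δ }

  absorb : ∀ {W x A} → (x , A) ∈ˡ sequent W → (W ▸ ((x , A) ∷ [])) ⟶ W
  absorb A∈ = record { to = id ; edges = edge ; formulas = λ { (here refl) → A∈ ; (there i) → i } }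

  enlarge-map : ∀ {V W} (f : V ⟶ W) Δ → (V ▸ Δ) ⟶ (W ▸ map (map₁ (to f)) Δ)
  enlarge-map f Δ = record
    { to       = to f
    ; edges    = edges f
    ; formulas = [ ∈-++⁺ˡ ∘ ∈-map⁺ (map₁ (to f)) , ∈-++⁺ʳ _ ∘ formulas f ]′ ∘ ∈-++⁻ Δ
    }

  into-sprout : ∀ {W} x d → W ⟶ sprout W x d
  into-sprout x d = record { to = suc ; edges = edge ∘ there ; formulas = ∈-shift⁺ }

  sprout-map : ∀ {V W} (f : V ⟶ W) x d → sprout V x d ⟶ sprout W (to f x) d
  sprout-map {V} {W} f x d = record { to = to′ ; edges = edges′ ; formulas = formulas′ }
    where
    to′ : Fin (suc (size V)) → Fin (suc (size W))
    to′ zero    = zero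
    to′ (suc y) = suc (to f y)

    edges′ : ∀ {e y z} → Edge (grow (tree V) x d) e y z →
             Reach (grow (tree W) (to f x) d) e (to′ y) (to′ z)
    edges′ here      = edge here
    edges′ (there e) = reaches (into-sprout {W} (to f x) d) (edges f e)

    formulas′ : ∀ {y A} → (y , A) ∈ˡ shift (sequent V) → (to′ y , A) ∈ˡ shift (sequent W)
    formulas′ A∈ with ∈-shift⁻ A∈
    ... | _ , refl , A∈V = ∈-shift⁺ (formulas f A∈V)

  -- Every rule survives relocation along a morphism; at a box rule both worlds sprout a leaf and
  -- the morphism is extended to it.
  weaken : ∀ {V W} → V ⟶ W → Provable V → Provable W
  weaken f (atoms i j)          = atoms (formulas f i) (formulas f j)
  weaken f (⊤-rule i)           = ⊤-rule (formulas f i)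
  weaken f (∧-rule i D E)       = ∧-rule (formulas f i) (weaken (enlarge-map f _) D) (weaken (enlarge-map f _) E)
  weaken f (∨-rule i D)         = ∨-rule (formulas f i) (weaken (enlarge-map f _) D)
  weaken f (box-rule d i D)     = box-rule d (formulas f i) (weaken (enlarge-map (sprout-map f _ d) _) D)
  weaken f (diamond-rule d i r D) =
    diamond-rule d (formulas f i) (reaches f r) (weaken (enlarge-map f _) D)

  -- Forcing predicates

  WPred : Set₁
  WPred = (W : World) → Node W → Set

  infix 4 _≤_
  _≤_ : WPred → WPred → Set
  X ≤ Y = ∀ {W x} → X W x → Y W x

  Neg : WPred → WPred
  Neg X W x = ∀ {V} (f : W ⟶ V) → X V (to f x) → Provable V

  And : WPred → WPred → WPred
  And X Y W x = X W x × Y W x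

  Box : Diamond → WPred → WPred
  Box d X W x = ∀ {V} (f : W ⟶ V) {y} → Reach (tree V) d (to f x) y → X V y

  -- `Stable` is double negation elimination with provability as falsity; it makes the forcing
  -- classical.
  Persistent Stable : WPred → Set
  Persistent X = ∀ {W V x} (f : W ⟶ V) → X W x → X V (to f x)
  Stable X = Neg (Neg X) ≤ X

  Neg-persistent : ∀ {X} → Persistent (Neg X)
  Neg-persistent f nx g = nx (g ∘ʷ f)

  And-persistent : ∀ {X Y} → Persistent X → Persistent Y → Persistent (And X Y)
  And-persistent l r f (a , b) = l f a , r f b

  Box-persistent : ∀ {d X} → Persistent (Box d X)
  Box-persistent f bx g = bx (g ∘ʷ f)

  Neg-Neg : ∀ {X} → Persistent X → X ≤ Neg (Neg X)
  Neg-Neg persistent a f nx = nx idʷ (persistent f a)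

  Neg-stable : ∀ {X} → Persistent X → Stable (Neg X)
  Neg-stable persistent n f a = n f λ g na → na idʷ (persistent g a)

  And-stable : ∀ {X Y} → Stable X → Stable Y → Stable (And X Y)
  And-stable l r nn = l (λ f nx → nn f λ g (a , _) → nx g a) , r (λ f ny → nn f λ g (_ , b) → ny g b)

  Box-stable : ∀ {d X} → Stable X → Stable (Box d X)
  Box-stable stable nn f r = stable λ g nx → nn (g ∘ʷ f) λ h bx → nx h (bx idʷ (reaches (h ∘ʷ g) r))

  -- An atom counts as true where adding it to the sequent at that node gives a provable sequent. If
  -- it is already there, this is provability itself.
  Atom : Var → WPred
  Atom p W x = Provable (W ▸ ((x , pos p) ∷ []))

  -- A negative translation: disjunctions and diamonds are defined through `Neg` from their duals,
  -- so that every formula is stable.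
  Force : Formula → WPred
  Force (pos p)     = Atom p
  Force (neg p)     = Neg (Atom p)
  Force ⊤       W x = Unit
  Force ⊥       W x = Provable W
  Force (A ∧ B)     = And (Force A) (Force B)
  Force (A ∨ B)     = Neg (And (Neg (Force A)) (Neg (Force B)))
  Force (□ A)       = Box future (Force A)
  Force (◇ A)       = Neg (Box future (Neg (Force A)))
  Force (■ A)       = Box past (Force A)
  Force (P A)       = Neg (Box past (Neg (Force A)))

  persist : ∀ A → Persistent (Force A)
  persist (pos p) f = weaken (enlarge-map f _)
  persist (neg p)   = Neg-persistent {Force (pos p)}
  persist ⊤ f       = id
  persist ⊥ f       = weaken f
  persist (A ∧ B)   = And-persistent {Force A} {Force B} (persist A) (persist B)
  persist (A ∨ B)   = Neg-persistent {And (Neg (Force A)) (Neg (Force B))}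
  persist (□ A)     = Box-persistent {X = Force A}
  persist (◇ A)     = Neg-persistent {Box future (Neg (Force A))}
  persist (■ A)     = Box-persistent {X = Force A}
  persist (P A)     = Neg-persistent {Box past (Neg (Force A))}

  persist-¬¬ : ∀ A B → Persistent (And (Neg (Force A)) (Neg (Force B)))
  persist-¬¬ A B =
    And-persistent {Neg (Force A)} {Neg (Force B)} (Neg-persistent {Force A}) (Neg-persistent {Force B})

  stable : ∀ A → Stable (Force A)
  -- Once `pos p` has been added, adding it again changes nothing, so every further extension
  -- forcing the atom is provable.
  stable (pos p) nn = nn (enlarge _) λ f → weaken (absorb (formulas f (here refl)))
  stable (neg p)    = Neg-stable {Force (pos p)} (persist (pos p))
  stable ⊤ nn       = tt
  stable ⊥ nn       = nn idʷ λ f → id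
  stable (A ∧ B)    = And-stable {Force A} {Force B} (stable A) (stable B)
  stable (A ∨ B)    = Neg-stable {And (Neg (Force A)) (Neg (Force B))} (persist-¬¬ A B)
  stable (□ A)      = Box-stable {X = Force A} (stable A)
  stable (◇ A)      = Neg-stable {Box future (Neg (Force A))} (Box-persistent {X = Neg (Force A)})
  stable (■ A)      = Box-stable {X = Force A} (stable A)
  stable (P A)      = Neg-stable {Box past (Neg (Force A))} (Box-persistent {X = Neg (Force A)})

  -- Induction on `A`: the rule for its main connective, read upwards, leads to worlds that contain
  -- its immediate subformulas, where these can be reflected in turn.
  reflect : ∀ A {W x} → (x , A) ∈ˡ sequent W → Force A W x → Provable W
  reflect (pos p) i a = weaken (absorb i) a
  reflect (neg p) i a = a idʷ (atoms (here refl) (there i))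
  reflect ⊤ i a       = ⊤-rule i
  reflect ⊥ i a       = a
  reflect (A ∧ B) i (a , b) =
    ∧-rule i (reflect A (here refl) (persist A (enlarge _) a))
             (reflect B (here refl) (persist B (enlarge _) b))
  reflect (A ∨ B) i a =
    ∨-rule i (a (enlarge (_ ∷ _ ∷ [])) ( (λ f → reflect A (formulas f (here refl)))
                                       , (λ f → reflect B (formulas f (there (here refl))))))
  reflect (□ A) i a =
    box-rule future i (reflect A (here refl) (a (enlarge _ ∘ʷ into-sprout _ future) (edge here)))
  reflect (■ A) i a =
    box-rule past i (reflect A (here refl) (a (enlarge _ ∘ʷ into-sprout _ past) (edge here)))
  -- It suffices to refute `A` at every reachable node of every extension; there the diamond rule
  -- copies `A` to that node.
  reflect (◇ A) i a = a idʷ λ f r g b →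
    diamond-rule future (formulas (g ∘ʷ f) i) (reaches g r)
      (reflect A (here refl) (persist A (enlarge _) b))
  reflect (P A) i a = a idʷ λ f r g b →
    diamond-rule past (formulas (g ∘ʷ f) i) (reaches g r)
      (reflect A (here refl) (persist A (enlarge _) b))

  -- Syntactic and semantic negation agree. Conjunctions and boxes need the contrapositives `Neg-∼⇒`
  -- and `⇒Neg-∼`, hence the mutual recursion.
  ∼⇒Neg : ∀ A → Force (∼ A) ≤ Neg (Force A)
  Neg⇒∼ : ∀ A → Neg (Force A) ≤ Force (∼ A)

  Neg-∼⇒ : ∀ A → Neg (Force (∼ A)) ≤ Force A
  Neg-∼⇒ A n = stable A λ f na → n f (Neg⇒∼ A na)

  ⇒Neg-∼ : ∀ A → Force A ≤ Neg (Force (∼ A))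
  ⇒Neg-∼ A a f na = ∼⇒Neg A na idʷ (persist A f a)

  ∼⇒Neg (pos p) n       = n
  ∼⇒Neg (neg p) a       = Neg-Neg {Force (pos p)} (persist (pos p)) a
  ∼⇒Neg ⊤ a f _         = weaken f a
  ∼⇒Neg ⊥ _ f           = id
  ∼⇒Neg (A ∧ B) n f (a , b) = n f (⇒Neg-∼ A a , ⇒Neg-∼ B b)
  ∼⇒Neg (A ∨ B) (a , b) f n = n idʷ (∼⇒Neg A (persist (∼ A) f a) , ∼⇒Neg B (persist (∼ B) f b))
  ∼⇒Neg (□ A) n f bx    = n f λ g r → ⇒Neg-∼ A (bx g r)
  ∼⇒Neg (◇ A) bx f n    = n idʷ λ g r → ∼⇒Neg A (bx (g ∘ʷ f) r)
  ∼⇒Neg (■ A) n f bx    = n f λ g r → ⇒Neg-∼ A (bx g r)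
  ∼⇒Neg (P A) bx f n    = n idʷ λ g r → ∼⇒Neg A (bx (g ∘ʷ f) r)

  Neg⇒∼ (pos p) n       = n
  Neg⇒∼ (neg p) n       = stable (pos p) n
  Neg⇒∼ ⊤ n             = n idʷ tt
  Neg⇒∼ ⊥ n             = tt
  Neg⇒∼ (A ∧ B) n f (a , b) = n f (Neg-∼⇒ A a , Neg-∼⇒ B b)
  Neg⇒∼ (A ∨ B) n =
    Neg⇒∼ A (λ f a → n f λ g (na , nb) → na idʷ (persist A g a)) ,
    Neg⇒∼ B (λ f b → n f λ g (na , nb) → nb idʷ (persist B g b))
  Neg⇒∼ (□ A) n f bx    = n f λ g r → Neg-∼⇒ A (bx g r)
  Neg⇒∼ (◇ A) n f r     = Neg⇒∼ A λ g a → n (g ∘ʷ f) λ h bx → bx idʷ (reaches (h ∘ʷ g) r) idʷ (persist A h a)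
  Neg⇒∼ (■ A) n f bx    = n f λ g r → Neg-∼⇒ A (bx g r)
  Neg⇒∼ (P A) n f r     = Neg⇒∼ A λ g a → n (g ∘ʷ f) λ h bx → bx idʷ (reaches (h ∘ʷ g) r) idʷ (persist A h a)

  -- Soundness of the Hilbert system for forcing

  Forced : Formula → Set
  Forced A = ∀ W x → Force A W x

  ∨-intro : ∀ A B {W x} →
            (∀ {V} (f : W ⟶ V) → Neg (Force A) V (to f x) → Force B V (to f x)) → Force (A ∨ B) W x
  ∨-intro A B h f (na , nb) = nb idʷ (h f na)

  Forceᵈ : Diamond → Formula → WPred
  Forceᵈ d A = Neg (Box d (Neg (Force A)))

  diamond-Force : ∀ d A → Force (⟨ d ⟩ A) ≡ Forceᵈ d A
  diamond-Force future A = refl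
  diamond-Force past   A = refl

  -- A chain of forced diamonds is unwound one step at a time. Each diamond can be eliminated only
  -- towards falsity, so the conclusion is provability of the world.
  path-forced : ∀ ds A {W x} → Force (foldr ⟨_⟩_ A ds) W x →
                (∀ {V} (f : W ⟶ V) {y} → Path (Reach (tree V)) ds (to f x) y → Neg (Force A) V y) →
                Provable W
  path-forced []       A a n = n idʷ [] idʷ a
  path-forced (d ∷ ds) A a n rewrite diamond-Force d (foldr ⟨_⟩_ A ds) =
    a idʷ λ f r g b → path-forced ds A b λ h rs → n (h ∘ʷ g ∘ʷ f) (reaches (h ∘ʷ g) r ∷ rs)

  module _ (σ : Var → Formula) where
    letters : PropFormula → List Var
    letters (posᵖ p) = p ∷ []
    letters (negᵖ p) = p ∷ []
    letters ⊤ᵖ       = []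
    letters ⊥ᵖ       = []
    letters (φ ∧ᵖ ψ) = letters φ ++ letters ψ
    letters (φ ∨ᵖ ψ) = letters φ ++ letters ψ

    Literal : Bool → Var → WPred
    Literal b p = Force (if b then σ p else ∼ σ p)

    Describes : (Var → Bool) → List Var → WPred
    Describes v L W x = ∀ {p} → p ∈ˡ L → Literal (v p) p W x

    persist-literal : ∀ b p → Persistent (Literal b p)
    persist-literal b p = persist (if b then σ p else ∼ σ p)

    update : (Var → Bool) → Var → Bool → Var → Bool
    update v p b q with q ≟ p
    ... | yes _ = b
    ... | no  _ = v q

    describes-update : ∀ {v p b L W x} → Literal b p W x → Describes v L W x →
                       Describes (update v p b) (p ∷ L) W x
    describes-update {p = p} l D {q} i with q ≟ p
    describes-update         l D {q} i         | yes refl = l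
    describes-update         l D {q} (here eq) | no  q≢p with () ← q≢p eq
    describes-update         l D {q} (there i) | no  _   = D i

    -- The excluded middle for the finitely many letters, in double-negated form.
    decide : ∀ L {W x} → Neg (λ V y → Σ[ v ∈ (Var → Bool) ] Describes v L V y) W x → Provable W
    decide []      n = n idʷ ((λ _ → true) , λ ())
    decide (p ∷ L) n = decide L λ f (v , D) →
      -- The value `false` requires `∼ σ p` to be forced: any extension that forces `σ p` is made
      -- provable by choosing `true` there instead.
      n f ( update v p false
          , describes-update
              (Neg⇒∼ (σ p) λ g a →
                 n (g ∘ʷ f) ( update v p true
                            , describes-update a (λ {q} i → persist-literal (v q) q g (D i))))
              D)

    eval-forced : ∀ φ v {W x} → eval v φ ≡ true → Describes v (letters φ) W x → Force (subst σ φ) W x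
    eval-forced (posᵖ p) v eq D with v p | D (here refl)
    ... | true | a = a
    eval-forced (negᵖ p) v eq D with v p | D (here refl)
    ... | false | a = a
    eval-forced ⊤ᵖ v eq D = tt
    eval-forced (φ ∧ᵖ ψ) v eq D =
      eval-forced φ v (∧-conicalˡ _ _ eq) (D ∘ ∈-++⁺ˡ) ,
      eval-forced ψ v (∧-conicalʳ (eval v φ) _ eq) (D ∘ ∈-++⁺ʳ (letters φ))
    eval-forced (φ ∨ᵖ ψ) v eq D f (na , nb) with eval v φ in eqφ
    ... | true  = na idʷ (persist (subst σ φ) f (eval-forced φ v eqφ (D ∘ ∈-++⁺ˡ)))
    ... | false = nb idʷ (persist (subst σ ψ) f (eval-forced ψ v eq (D ∘ ∈-++⁺ʳ (letters φ))))

    -- Stability turns the goal into provability, so `decide` may supply a valuation of the letters,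
    -- under which `φ` evaluates to `true`.
    tautology-forced : ∀ φ → Tautology φ → Forced (subst σ φ)
    tautology-forced φ τ W x = stable (subst σ φ) λ f n →
      decide (letters φ) λ g (v , D) → n g (eval-forced φ v (τ v) D)

  -- Each hypothesis is a doubly negated `Box`, which `Box-stable` releases: at a reachable node `A`
  -- is forced and `A ∧ ∼ B` is refuted.
  dist-forced : ∀ d A B {W x} → Neg (Forceᵈ d (A ∧ ∼ B)) W x → Neg (Forceᵈ d (∼ A)) W x → Box d (Force B) W x
  dist-forced d A B n m f r = stable B λ g nb →
    Box-stable {X = Neg (Force (A ∧ ∼ B))} (Neg-stable {Force (A ∧ ∼ B)} (persist (A ∧ ∼ B))) n (g ∘ʷ f) (reaches g r) idʷ
      ( Neg-∼⇒ A (Box-stable {X = Neg (Force (∼ A))} (Neg-stable {Force (∼ A)} (persist (∼ A))) m (g ∘ʷ f) (reaches g r))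
      , Neg⇒∼ B nb)

  -- The converse axioms hold since `Reach` has `converse`, the path axioms since it has `closed`.
  forced : ∀ {A} → Kt⟨ Π ⟩ A → Forced A
  forced (taut φ σ τ)   W x = tautology-forced σ φ τ W x
  forced (conv-□ A)     W x = ∨-intro (∼ A) (□ P A) λ f a g r h bx →
    bx idʷ (converse (reaches h r)) idʷ (persist A (h ∘ʷ g) (Neg-∼⇒ A a))
  forced (conv-■ A)     W x = ∨-intro (∼ A) (■ ◇ A) λ f a g r h bx →
    bx idʷ (converse (reaches h r)) idʷ (persist A (h ∘ʷ g) (Neg-∼⇒ A a))
  forced (dist-□ A B)   W x = ∨-intro (◇ (A ∧ ∼ B)) (◇ (∼ A) ∨ □ B) λ f n → ∨-intro (◇ (∼ A)) (□ B) λ g m →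
    dist-forced future A B (Neg-persistent {Force (◇ (A ∧ ∼ B))} g n) m
  forced (dist-■ A B)   W x = ∨-intro (P (A ∧ ∼ B)) (P (∼ A) ∨ ■ B) λ f n → ∨-intro (P (∼ A)) (■ B) λ g m →
    dist-forced past A B (Neg-persistent {Force (P (A ∧ ∼ B))} g n) m
  forced (pathAx {path ds d} π A) W x = ∨-intro (∼ foldr ⟨_⟩_ A ds) (⟨ d ⟩ A) λ f a → 
    ≡.subst (λ X → X _ _) (sym (diamond-Force d A)) λ g bx →
      path-forced ds A (persist (foldr ⟨_⟩_ A ds) g (Neg-∼⇒ (foldr ⟨_⟩_ A ds) a))
        λ h rs → bx h (closed π rs)
  -- By stability `B` may be assumed refuted; as `∼ A` is refuted too, the forced disjunction
  -- `∼ A ∨ B` gives provability.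
  forced (mp {A} {B} D E) W x = stable B λ f nb →
    forced E W x f ((λ g na → ∼⇒Neg A na idʷ (forced D _ _)) , nb)
  forced (nec-□ D) W x f r = forced D _ _
  forced (nec-■ D) W x f r = forced D _ _

  -- In the world whose sequent is `A`, `B` itself, `reflect` refutes both disjuncts, so the forced
  -- disjunction makes this world provable.
  cutfree-complete : ∀ A B → Kt⟨ Π ⟩ (A ∨ B) → Cutfree root ((zero , A) ∷ (zero , B) ∷ [])
  cutfree-complete A B D = forced D (world root _) zero idʷ
    ( (λ f → reflect A (formulas f (here refl))) , (λ f → reflect B (formulas f (there (here refl)))) )

  -- Hilbert provability of tree sequents

  infix 4 ⊢_
  ⊢_ : Formula → Set
  ⊢ A = Kt⟨ Π ⟩ A

  module _ (A B C : Formula) where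
    infix 10 ⟦_⟧
    ⟦_⟧ : PropFormula → Formula
    ⟦ φ ⟧ = subst (assign A B C) φ

    rule₀ : ∀ φ → truthTable φ ≡ true → ⊢ ⟦ φ ⟧
    rule₀ φ eq = ≡.subst ⊢_ (subst-clamp A B C φ) (taut (clamp φ) (assign A B C) (truthTable-sound φ eq))

    rule₁ : ∀ φ ψ → truthTable (∼ᵖ φ ∨ᵖ ψ) ≡ true → ⊢ ⟦ φ ⟧ → ⊢ ⟦ ψ ⟧
    rule₁ φ ψ eq D = mp D
      (≡.subst (λ X → ⊢ X ∨ ⟦ ψ ⟧) (subst-∼ (assign A B C) φ) (rule₀ (∼ᵖ φ ∨ᵖ ψ) eq))

    rule₂ : ∀ φ χ ψ → truthTable (∼ᵖ φ ∨ᵖ (∼ᵖ χ ∨ᵖ ψ)) ≡ true → ⊢ ⟦ φ ⟧ → ⊢ ⟦ χ ⟧ → ⊢ ⟦ ψ ⟧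
    rule₂ φ χ ψ eq D E = mp E
      (≡.subst (λ X → ⊢ X ∨ ⟦ ψ ⟧) (subst-∼ (assign A B C) χ) (rule₁ φ (∼ᵖ χ ∨ᵖ ψ) eq D))

  ⇒-refl : ∀ A → ⊢ A ⇒ A
  ⇒-refl A = rule₀ A A A (n₀ ∨ᵖ p₀) refl

  ⇒-trans : ∀ {A B C} → ⊢ A ⇒ B → ⊢ B ⇒ C → ⊢ A ⇒ C
  ⇒-trans {A} {B} {C} = rule₂ A B C (n₀ ∨ᵖ p₁) (n₁ ∨ᵖ p₂) (n₀ ∨ᵖ p₂) refl

  ∨-left : ∀ {A} B → ⊢ A ⇒ A ∨ B
  ∨-left {A} B = rule₀ A B B (n₀ ∨ᵖ (p₀ ∨ᵖ p₁)) refl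

  ∨-right : ∀ A {B} → ⊢ B ⇒ A ∨ B
  ∨-right A {B} = rule₀ A B B (n₁ ∨ᵖ (p₀ ∨ᵖ p₁)) refl

  ∨-least : ∀ {A B C} → ⊢ A ⇒ C → ⊢ B ⇒ C → ⊢ A ∨ B ⇒ C
  ∨-least {A} {B} {C} = rule₂ A B C (n₀ ∨ᵖ p₂) (n₁ ∨ᵖ p₂) ((n₀ ∧ᵖ n₁) ∨ᵖ p₂) refl

  ⋁-upper : ∀ {A N} → A ∈ˡ N → ⊢ A ⇒ ⋁ N
  ⋁-upper {N = B ∷ N} (here refl) = ∨-left (⋁ N)
  ⋁-upper {N = B ∷ N} (there i)   = ⇒-trans (⋁-upper i) (∨-right B)

  ⋁-least : ∀ N {B} → (∀ {A} → A ∈ˡ N → ⊢ A ⇒ B) → ⊢ ⋁ N ⇒ B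
  ⋁-least []      {B} h = rule₀ B B B (⊤ᵖ ∨ᵖ p₀) refl
  ⋁-least (A ∷ N) {B} h = ∨-least (h (here refl)) (⋁-least N (h ∘ there))

  ⋁-mono : ∀ {M N} → M ⊆ˡ N → ⊢ ⋁ M ⇒ ⋁ N
  ⋁-mono M⊆N = ⋁-least _ (⋁-upper ∘ M⊆N)

  ⋀-intro : ∀ B N → (∀ {A} → A ∈ˡ N → ⊢ A ∨ B) → ⊢ ⋀ N ∨ B
  ⋀-intro B []      h = rule₀ B B B (⊤ᵖ ∨ᵖ p₀) refl
  ⋀-intro B (A ∷ N) h = rule₂ A (⋀ N) B (p₀ ∨ᵖ p₂) (p₁ ∨ᵖ p₂) ((p₀ ∧ᵖ p₁) ∨ᵖ p₂) refl
    (h (here refl)) (⋀-intro B N (h ∘ there))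

  ⋀-lower : ∀ {A N} → A ∈ˡ N → ⊢ ⋀ N ⇒ A
  ⋀-lower {A} {_ ∷ N} (here refl) = rule₀ A (⋀ N) A ((n₀ ∨ᵖ n₁) ∨ᵖ p₀) refl
  ⋀-lower {A} {B ∷ N} (there i) =
    rule₁ B (⋀ N) A (n₁ ∨ᵖ p₂) ((n₀ ∨ᵖ n₁) ∨ᵖ p₂) refl (⋀-lower i)

  -- Derived modal principles

  nec : ∀ d {A} → ⊢ A → ⊢ [ d ] A
  nec future = nec-□
  nec past   = nec-■

  dist : ∀ d A B → ⊢ ⟨ d ⟩ (A ∧ ∼ B) ∨ ⟨ d ⟩ (∼ A) ∨ [ d ] B
  dist future = dist-□
  dist past   = dist-■

  conv : ∀ d A → ⊢ A ⇒ [ d ] ⟨ d ° ⟩ A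
  conv future = conv-□
  conv past   = conv-■

  box-K : ∀ d {A B} → ⊢ [ d ] (A ⇒ B) → ⊢ [ d ] A ⇒ [ d ] B
  box-K d {A} {B} D = mp D (≡.subst ⊢_ eq (dist d A B))
    where
    eq : ⟨ d ⟩ (A ∧ ∼ B) ∨ ⟨ d ⟩ (∼ A) ∨ [ d ] B ≡ ∼ ([ d ] (A ⇒ B)) ∨ ∼ ([ d ] A) ∨ [ d ] B
    eq = cong₂ _∨_ (trans (cong (λ X → ⟨ d ⟩ (X ∧ ∼ B)) (sym (∼-involutive A))) (sym (∼-box d (A ⇒ B))))
                   (cong (_∨ [ d ] B) (sym (∼-box d A)))

  box-mono : ∀ d {A B} → ⊢ A ⇒ B → ⊢ [ d ] A ⇒ [ d ] B
  box-mono d D = box-K d (nec d D)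

  -- Distribution at `∼ A`. It takes `A` out of the boxed leaf and leaves `⟨ d ⟩ A` at the parent.
  box-∨ : ∀ d A B → ⊢ [ d ] (A ∨ B) ⇒ [ d ] B ∨ ⟨ d ⟩ A
  box-∨ d A B = rule₁ ([ d ] (A ∨ B)) (⟨ d ⟩ A) ([ d ] B) (n₀ ∨ᵖ (p₁ ∨ᵖ p₂)) (n₀ ∨ᵖ (p₂ ∨ᵖ p₁)) refl
    (≡.subst ⊢_ eq (dist d (∼ A) B))
    where
    eq : ⟨ d ⟩ (∼ A ∧ ∼ B) ∨ ⟨ d ⟩ (∼ ∼ A) ∨ [ d ] B ≡ ∼ ([ d ] (A ∨ B)) ∨ ⟨ d ⟩ A ∨ [ d ] B
    eq = cong₂ _∨_ (sym (∼-box d (A ∨ B))) (cong (λ X → ⟨ d ⟩ X ∨ [ d ] B) (∼-involutive A))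

  box-∧ : ∀ d A B → ⊢ [ d ] A ∧ [ d ] B ⇒ [ d ] (A ∧ B)
  box-∧ d A B = rule₁ ([ d ] A) ([ d ] B) ([ d ] (A ∧ B)) (n₀ ∨ᵖ (n₁ ∨ᵖ p₂)) ((n₀ ∨ᵖ n₁) ∨ᵖ p₂) refl
    (⇒-trans (box-mono d (rule₀ A B B (n₀ ∨ᵖ (n₁ ∨ᵖ (p₀ ∧ᵖ p₁))) refl))
             (≡.subst ⊢_ eq (dist d B (A ∧ B))))
    where
    eq : ⟨ d ⟩ (B ∧ ∼ (A ∧ B)) ∨ ⟨ d ⟩ (∼ B) ∨ [ d ] (A ∧ B) ≡ ∼ ([ d ] (B ⇒ A ∧ B)) ∨ ∼ ([ d ] B) ∨ [ d ] (A ∧ B)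
    eq = cong₂ _∨_ (trans (cong (λ X → ⟨ d ⟩ (X ∧ ∼ (A ∧ B))) (sym (∼-involutive B))) (sym (∼-box d (B ⇒ A ∧ B))))
                   (cong (_∨ [ d ] (A ∧ B)) (sym (∼-box d B)))

  -- Leaves are eliminated youngest first, which makes the box rule and its inverse definitional.
  flatten : ∀ {n} → Tree n → Sequent n → Formula
  flatten root         Γ = ⋁ (map proj₂ Γ)
  flatten (grow T x d) Γ = flatten T ((x , [ d ] ⋁ (leaf Γ)) ∷ trunk Γ)

  Valid : ∀ {n} → Tree n → Sequent n → Set
  Valid T Γ = ⊢ flatten T Γ

  Below : ∀ {n} → Sequent n → Fin n → Formula → Set
  Below Γ x A = ∃[ N ] (∀ {B} → B ∈ˡ N → (x , B) ∈ˡ Γ) × ⊢ A ⇒ ⋁ N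

  infix 4 _⊑_
  -- One comparison for structural rules and for Hilbert consequence at a node. The empty
  -- disjunction is allowed and discards contradictory formulas.
  _⊑_ : ∀ {n} → Sequent n → Sequent n → Set
  Γ ⊑ Δ = ∀ {x A} → (x , A) ∈ˡ Γ → Below Δ x A

  below : ∀ {n} {Γ : Sequent n} {x A B} → (x , B) ∈ˡ Γ → ⊢ A ⇒ B → Below Γ x A
  below i D = _ ∷ [] , (λ { (here refl) → i }) , ⇒-trans D (∨-left ⊥)

  below₂ : ∀ {n} {Γ : Sequent n} {x A B C} → (x , B) ∈ˡ Γ → (x , C) ∈ˡ Γ → ⊢ A ⇒ B ∨ C → Below Γ x A
  below₂ {B = B} {C} i j D =
    B ∷ C ∷ [] , (λ { (here refl) → i ; (there (here refl)) → j }) ,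
    ⇒-trans D (∨-least (∨-left (C ∨ ⊥)) (⇒-trans (∨-left ⊥) (∨-right B)))

  ∈⇒below : ∀ {n} {Γ : Sequent n} {x A} → (x , A) ∈ˡ Γ → Below Γ x A
  ∈⇒below i = below i (⇒-refl _)

  ∷-⊑ : ∀ {n} {Γ Δ : Sequent n} {x A} → Below Δ x A → Γ ⊆ˡ Δ → (x , A) ∷ Γ ⊑ Δ
  ∷-⊑ b Γ⊆Δ (here refl) = b
  ∷-⊑ b Γ⊆Δ (there i)   = ∈⇒below (Γ⊆Δ i)

  -- Recursion on the tree: eliminating the youngest leaf preserves the comparison because boxes are
  -- monotone.
  valid-⊑ : ∀ {n} (T : Tree n) {Γ Δ} → Γ ⊑ Δ → Valid T Γ → Valid T Δ
  valid-⊑ root {Γ} {Δ} Γ⊑Δ D = mp D (⋁-least _ step)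
    where
    step : ∀ {A} → A ∈ˡ map proj₂ Γ → ⊢ A ⇒ ⋁ (map proj₂ Δ)
    step i with ∈-map⁻ proj₂ i
    ... | (x , A) , i′ , refl with Γ⊑Δ i′
    ... | N , N⊆Δ , E = ⇒-trans E (⋁-mono (∈-map⁺ proj₂ ∘ N⊆Δ))
  valid-⊑ (grow T x d) {Γ} {Δ} Γ⊑Δ = valid-⊑ T λ
    { (here refl) → below (here refl) (box-mono d (⋁-least (leaf Γ) step))
    ; (there i)   → let (N , N⊆Δ , E) = Γ⊑Δ (∈-trunk⁻ Γ i) in N , there ∘ ∈-trunk⁺ Δ ∘ N⊆Δ , E
    }
    where
    step : ∀ {A} → A ∈ˡ leaf Γ → ⊢ A ⇒ ⋁ (leaf Δ)
    step i with Γ⊑Δ (∈-leaf⁻ Γ i)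
    ... | N , N⊆Δ , E = ⇒-trans E (⋁-mono (∈-leaf⁺ Δ ∘ N⊆Δ))

  valid-⊆ : ∀ {n} (T : Tree n) {Γ Δ} → Γ ⊆ˡ Δ → Valid T Γ → Valid T Δ
  valid-⊆ T Γ⊆Δ = valid-⊑ T (∈⇒below ∘ Γ⊆Δ)

  valid-∷ : ∀ {n} (T : Tree n) {Γ x A} → Below Γ x A → Valid T ((x , A) ∷ Γ) → Valid T Γ
  valid-∷ T b = valid-⊑ T (∷-⊑ b id)

  valid-⇒ : ∀ {n} (T : Tree n) {Γ x A B} → ⊢ A ⇒ B → Valid T ((x , A) ∷ Γ) → Valid T ((x , B) ∷ Γ)
  valid-⇒ T D = valid-⊑ T (∷-⊑ (below (here refl) D) there)

  valid-swap : ∀ {n} (T : Tree n) {Γ a b} → Valid T (a ∷ b ∷ Γ) → Valid T (b ∷ a ∷ Γ)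
  valid-swap T = valid-⊆ T ∷-⊆-swap

  valid-theorem : ∀ {n} (T : Tree n) {Γ x A} → (x , A) ∈ˡ Γ → ⊢ A → Valid T Γ
  valid-theorem root i D = mp D (⋁-upper (∈-map⁺ proj₂ i))
  valid-theorem (grow T y d) {Γ} {zero}  i D =
    valid-theorem T (here refl) (nec d (mp D (⋁-upper (∈-leaf⁺ Γ i))))
  valid-theorem (grow T y d) {Γ} {suc x} i D = valid-theorem T (there (∈-trunk⁺ Γ i)) D

  valid-∧ : ∀ {n} (T : Tree n) {Γ x A B} →
            Valid T ((x , A) ∷ Γ) → Valid T ((x , B) ∷ Γ) → Valid T ((x , A ∧ B) ∷ Γ)
  valid-∧ root {Γ} {A = A} {B} = rule₂ A B (⋁ (map proj₂ Γ)) (p₀ ∨ᵖ p₂) (p₁ ∨ᵖ p₂) ((p₀ ∧ᵖ p₁) ∨ᵖ p₂) refl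
  valid-∧ (grow T y d) {Γ} {zero} {A} {B} D E =
    valid-⇒ T (⇒-trans (box-∧ d (A ∨ N) (B ∨ N))
                       (box-mono d (rule₀ A B N (((n₀ ∧ᵖ n₂) ∨ᵖ (n₁ ∧ᵖ n₂)) ∨ᵖ ((p₀ ∧ᵖ p₁) ∨ᵖ p₂)) refl)))
              (valid-∧ T D E)
    where N = ⋁ (leaf Γ)
  valid-∧ (grow T y d) {Γ} {suc x} D E = valid-swap T (valid-∧ T (valid-swap T D) (valid-swap T E))

  -- `Valid` is Hilbert provability, so cut is a conjunction followed by deletion of `A ∧ ∼ A`.
  valid-cut : ∀ {n} (T : Tree n) {Γ x A} → Valid T ((x , A) ∷ Γ) → Valid T ((x , ∼ A) ∷ Γ) → Valid T Γ
  valid-cut T {A = A} D E = valid-∷ T ([] , (λ ()) , contradictory) (valid-∧ T D E)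
    where
    contradictory : ⊢ A ∧ ∼ A ⇒ ⊥
    contradictory = ≡.subst (λ X → ⊢ (∼ A ∨ X) ∨ ⊥) (sym (∼-involutive A))
      (rule₀ A A A ((n₀ ∨ᵖ p₀) ∨ᵖ ⊥ᵖ) refl)

  valid-excluded-middle : ∀ {n} (T : Tree n) {Γ x A} → (x , A) ∈ˡ Γ → (x , ∼ A) ∈ˡ Γ → Valid T Γ
  valid-excluded-middle T {A = A} i j =
    valid-∷ T (below₂ i j (⇒-refl (A ∨ ∼ A)))
      (valid-theorem T (here refl) (rule₀ A A A (p₀ ∨ᵖ n₀) refl))

  propagate-edge : ∀ {n} {T : Tree n} {d x y} → Edge T d x y → ∀ {Γ A} →
                   Valid T ((y , A) ∷ Γ) → Valid T ((x , ⟨ d ⟩ A) ∷ Γ)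
  propagate-edge (here {T = T} {d = d}) {Γ} {A} D =
    valid-⊑ T (∷-⊑ (below₂ (here refl) (there (here refl)) (box-∨ d A (⋁ (leaf Γ)))) (λ i → there (there i))) D
  propagate-edge (there {T = T} e) D = valid-swap T (propagate-edge e (valid-swap T D))

  -- Soundness of the diamond rule, by induction on `Reach`: each closure condition is matched by an
  -- axiom.
  propagate      : ∀ {n} {T : Tree n} {d x y} → Reach T d x y → ∀ {Γ A} →
                   Valid T ((y , A) ∷ Γ) → Valid T ((x , ⟨ d ⟩ A) ∷ Γ)
  propagate-path : ∀ {n} {T : Tree n} {ds x y} → Path (Reach T) ds x y → ∀ {Γ A} →
                   Valid T ((y , A) ∷ Γ) → Valid T ((x , foldr ⟨_⟩_ A ds) ∷ Γ)

  propagate (edge e) = propagate-edge e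
  propagate {T = T} (converse {d} {x} {y} r) {Γ} {A} D =
    -- The cut formula is `[ d ] ⟨ d ° ⟩ A` at `x`. It follows from `A`, and its negation is a
    -- diamond that propagates along `r` to `y`, where it meets `⟨ d ° ⟩ A`.
    valid-cut T (valid-⇒ T (conv d A) (valid-⊆ T (∷-⊆-mono there) D))
      (≡.subst (λ X → Valid T ((x , X) ∷ (y , ⟨ d ° ⟩ A) ∷ Γ)) (sym (∼-box d _))
        (propagate r (valid-excluded-middle T (there (here refl)) (here refl))))
  propagate {T = T} (closed π rs) D = valid-⇒ T (pathAx π _) (propagate-path rs D)

  propagate-path []       D = D
  propagate-path (r ∷ rs) D = propagate r (propagate-path rs D)

  -- Interpolation

  -- A sequent interpolant is a conjunction of clauses J with  I ∨ Δ  and  I → Γ;  the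
  -- latter is expressed by quantifying over contexts S instead of by negating I.
  record Interpolant (Z : Pred Var 0ℓ) {n} (T : Tree n) (Γ Δ : Sequent n) : Set where
    field
      clauses    : List (Sequent n)
      vocabulary : ∀ {J x A} → J ∈ˡ clauses → (x , A) ∈ˡ J → var A ⊆ Z
      completes  : ∀ {J} → J ∈ˡ clauses → Valid T (J ++ Δ)
      entails    : ∀ S → (∀ {J} → J ∈ˡ clauses → Valid T (J ++ S)) → Valid T (Γ ++ S)
  open Interpolant

  -- Exchanging the two sides of an interpolant

  -- The negated conjunction of clauses, brought back to clausal form by distributivity: one clause
  -- for each choice of a formula from every old clause.
  transversals : ∀ {n} → List (Sequent n) → List (Sequent n)
  transversals []       = [] ∷ []
  transversals (J ∷ Js) = cartesianProductWith (λ (x , A) K → (x , ∼ A) ∷ K) J (transversals Js)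

  ∈-transversals : ∀ {n} (Js : List (Sequent n)) {K x B} → K ∈ˡ transversals Js → (x , B) ∈ˡ K →
                   ∃[ J ] ∃[ A ] (J ∈ˡ Js) × ((x , A) ∈ˡ J) × (B ≡ ∼ A)
  ∈-transversals []       (here refl) ()
  ∈-transversals (J ∷ Js) K∈ i with ∈-cartesianProductWith⁻ _ J (transversals Js) K∈ | i
  ... | (x , A) , K , A∈J , K∈′ , refl | here refl = J , A , here refl , A∈J , refl
  ... | (x , A) , K , A∈J , K∈′ , refl | there i′ =
    let (J′ , A′ , J∈ , A∈ , eq) = ∈-transversals Js K∈′ i′ in J′ , A′ , there J∈ , A∈ , eq

  transversal-meets : ∀ {n} (Js : List (Sequent n)) {J K} → J ∈ˡ Js → K ∈ˡ transversals Js →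
                      ∃[ x ] ∃[ A ] ((x , A) ∈ˡ J) × ((x , ∼ A) ∈ˡ K)
  transversal-meets (J ∷ Js) J∈ K∈ with ∈-cartesianProductWith⁻ _ J (transversals Js) K∈ | J∈
  ... | (x , A) , K , A∈J , K∈′ , refl | here refl = x , A , A∈J , here refl
  ... | (x , A) , K , A∈J , K∈′ , refl | there J∈′ =
    let (y , B , i , j) = transversal-meets Js J∈′ K∈′ in y , B , i , there j

  valid-cut* : ∀ {n} (T : Tree n) J {Γ} → (∀ {x A} → (x , A) ∈ˡ J → Valid T ((x , ∼ A) ∷ Γ)) →
               Valid T (J ++ Γ) → Valid T Γ
  valid-cut* T []            h D = D
  valid-cut* T ((x , A) ∷ J) h D = valid-cut* T J (h ∘ there)
    (valid-cut T D (valid-⊆ T (∷-⊆-mono (xs⊆ys++xs _ J)) (h (here refl))))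

  -- Clause by clause, `J` is cut against its negated formulas; each such formula joins the context
  -- `S` for the remaining clauses.
  transversals-entail : ∀ {n} (T : Tree n) Js {Δ} S → (∀ {J} → J ∈ˡ Js → Valid T (J ++ Δ)) →
                        (∀ {K} → K ∈ˡ transversals Js → Valid T (K ++ S)) → Valid T (Δ ++ S)
  transversals-entail T []       {Δ} S h k = valid-⊆ T (xs⊆ys++xs S Δ) (k (here refl))
  transversals-entail T (J ∷ Js) {Δ} S h k = valid-cut* T J
    (λ {x} {A} i → valid-⊆ T (move x A)
      (transversals-entail T Js ((x , ∼ A) ∷ S) (h ∘ there) λ {K} K∈ →
        valid-⊆ T (++-shift K) (k (∈-cartesianProductWith⁺ _ i K∈))))
    (valid-⊆ T (λ i → [ ∈-++⁺ˡ , ∈-++⁺ʳ J ∘ xs⊆xs++ys Δ S ]′ (∈-++⁻ J i)) (h (here refl)))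
    where
    move : ∀ x A → Δ ++ (x , ∼ A) ∷ S ⊆ˡ (x , ∼ A) ∷ Δ ++ S
    move x A = [ there ∘ ∈-++⁺ˡ , (λ { (here eq) → here eq ; (there i) → there (∈-++⁺ʳ Δ i) }) ]′ ∘ ∈-++⁻ Δ

    ++-shift : ∀ {a} K → a ∷ K ++ S ⊆ˡ K ++ a ∷ S
    ++-shift K (here eq) = ∈-++⁺ʳ K (here eq)
    ++-shift K (there i) = [ ∈-++⁺ˡ , ∈-++⁺ʳ K ∘ there ]′ (∈-++⁻ K i)

  module _ {Z : Pred Var 0ℓ} {n} {T : Tree n} where
    -- `entails` with a transversal as context gives the new `completes`, since every old clause
    -- meets the transversal in a complementary pair.
    interpolant-swap : ∀ {Γ Δ} → Interpolant Z T Γ Δ → Interpolant Z T Δ Γ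
    interpolant-swap {Γ} {Δ} I = record
      { clauses    = transversals (clauses I)
      ; vocabulary = λ K∈ i → let (_ , A , J∈ , A∈ , eq) = ∈-transversals (clauses I) K∈ i in
          ≡.subst (λ B → var B ⊆ Z) (sym eq) (vocabulary I J∈ A∈ ∘ var-∼ A)
      ; completes  = λ {K} K∈ → valid-⊆ T (++-⊆-swap Γ K) (entails I K λ {J} J∈ →
          let (_ , _ , i , j) = transversal-meets (clauses I) J∈ K∈ in
          valid-excluded-middle T (∈-++⁺ˡ i) (∈-++⁺ʳ J j))
      ; entails    = λ S → transversals-entail T (clauses I) S (completes I)
      }

    -- Interpolants for the individual rules

    interpolant-valid : ∀ {Γ Δ} → (∀ S → Valid T (Γ ++ S)) → Interpolant Z T Γ Δ
    interpolant-valid valid = record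
      { clauses = [] ; vocabulary = λ () ; completes = λ () ; entails = λ S _ → valid S }

    -- A one-premise rule acting on the left within a fixed tree affects `entails` alone, so the
    -- interpolant is kept.
    interpolant-premise : ∀ {Γ Γ′ Δ} → (∀ S → Valid T (Γ′ ++ S) → Valid T (Γ ++ S)) →
                          Interpolant Z T Γ′ Δ → Interpolant Z T Γ Δ
    interpolant-premise rule I = record
      { clauses    = clauses I
      ; vocabulary = vocabulary I
      ; completes  = completes I
      ; entails    = λ S → rule S ∘ entails I S
      }

    interpolant-atoms : ∀ {Γ Δ x p} → p ∈ Z → (x , pos p) ∈ˡ Γ → (x , neg p) ∈ˡ Δ → Interpolant Z T Γ Δ
    interpolant-atoms {Γ} {Δ} {x} {p} p∈Z i j = record
      { clauses    = ((x , pos p) ∷ []) ∷ []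
      ; vocabulary = λ { (here refl) (here refl) refl → p∈Z }
      ; completes  = λ { (here refl) → valid-excluded-middle T (here refl) (there j) }
      ; entails    = λ S h → valid-⊆ T (λ { (here refl) → ∈-++⁺ˡ i ; (there k) → ∈-++⁺ʳ Γ k }) (h (here refl))
      }

    interpolant-∧ : ∀ {Γ Δ x A B} → (x , A ∧ B) ∈ˡ Γ → Interpolant Z T ((x , A) ∷ Γ) Δ →
                    Interpolant Z T ((x , B) ∷ Γ) Δ → Interpolant Z T Γ Δ
    interpolant-∧ i I J = record
      { clauses    = clauses I ++ clauses J
      ; vocabulary = [ vocabulary I , vocabulary J ]′ ∘ ∈-++⁻ (clauses I)
      ; completes  = [ completes I , completes J ]′ ∘ ∈-++⁻ (clauses I)
      ; entails    = λ S h → valid-∷ T (∈⇒below (∈-++⁺ˡ i))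
          (valid-∧ T (entails I S (h ∘ ∈-++⁺ˡ)) (entails J S (h ∘ ∈-++⁺ʳ (clauses I))))
      }

    interpolant-∨ : ∀ {Γ Δ x A B} → (x , A ∨ B) ∈ˡ Γ → Interpolant Z T ((x , A) ∷ (x , B) ∷ Γ) Δ →
                    Interpolant Z T Γ Δ
    interpolant-∨ {A = A} {B} i = interpolant-premise λ S →
      valid-∷ T (below (∈-++⁺ˡ i) (∨-right A)) ∘ valid-∷ T (below (there (∈-++⁺ˡ i)) (∨-left B))

    interpolant-diamond : ∀ {Γ Δ x y d A} → (x , ⟨ d ⟩ A) ∈ˡ Γ → Reach T d x y →
                          Interpolant Z T ((y , A) ∷ Γ) Δ → Interpolant Z T Γ Δ
    interpolant-diamond i r = interpolant-premise λ S → valid-∷ T (∈⇒below (∈-++⁺ˡ i)) ∘ propagate r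

    collapse : Fin n → Diamond → Sequent (suc n) → Sequent n
    collapse x d J = (x , [ d ] ⋁ (leaf J)) ∷ trunk J

    collapse-shift : ∀ x d J S → Valid (grow T x d) (J ++ shift S) ≡ Valid T (collapse x d J ++ S)
    collapse-shift x d J S =
      cong₂ (λ N Γ → Valid T ((x , [ d ] ⋁ N) ∷ Γ)) (leaf-++-shift J S) (trunk-++-shift J S)

    -- `collapse` repeats the leaf elimination of `flatten`, so clauses on the grown tree and their
    -- collapses are valid together in any shifted context.
    interpolant-box : ∀ {Γ Δ x d A} → (x , [ d ] A) ∈ˡ Γ →
                      Interpolant Z (grow T x d) ((zero , A) ∷ shift Γ) (shift Δ) → Interpolant Z T Γ Δ
    interpolant-box {Γ} {Δ} {x} {d} {A} i I = record
      { clauses    = map (collapse x d) (clauses I)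
      ; vocabulary = vocabulary′
      ; completes  = completes′
      -- With `Γ` and `S` shifted, only `A` sits at the leaf, which collapses to `[ d ] (A ∨ ⊥)`.
      ; entails    = λ S h → valid-∷ T (below (∈-++⁺ˡ i) (box-mono d A∨⊥⇒A))
          (≡.subst id (cong₂ (λ N Θ → Valid T ((x , [ d ] (A ∨ ⋁ N)) ∷ Θ)) (leaf-shift₂ S) (trunk-shift₂ S))
            (entails I (shift S) λ {J} J∈ →
              ≡.subst id (sym (collapse-shift x d J S)) (h (∈-map⁺ (collapse x d) J∈))))
      }
      where
      leaf-shift₂ : ∀ S → leaf (shift Γ ++ shift S) ≡ []
      leaf-shift₂ S = trans (leaf-++-shift (shift Γ) S) (leaf-shift Γ)

      trunk-shift₂ : ∀ S → trunk (shift Γ ++ shift S) ≡ Γ ++ S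
      trunk-shift₂ S = trans (trunk-++-shift (shift Γ) S) (cong (_++ S) (trunk-shift Γ))

      A∨⊥⇒A : ⊢ A ∨ ⊥ ⇒ A
      A∨⊥⇒A = rule₀ A A A ((n₀ ∧ᵖ ⊤ᵖ) ∨ᵖ p₀) refl

      vocabulary′ : ∀ {K y B} → K ∈ˡ map (collapse x d) (clauses I) → (y , B) ∈ˡ K → var B ⊆ Z
      vocabulary′ K∈ j with ∈-map⁻ (collapse x d) K∈ | j
      ... | J , J∈ , refl | here refl = var-⋁ (leaf J) (vocabulary I J∈ ∘ ∈-leaf⁻ J) ∘ var-box d _
      ... | J , J∈ , refl | there j′  = vocabulary I J∈ (∈-trunk⁻ J j′)

      completes′ : ∀ {K} → K ∈ˡ map (collapse x d) (clauses I) → Valid T (K ++ Δ)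
      completes′ K∈ with ∈-map⁻ (collapse x d) K∈
      ... | J , J∈ , refl = ≡.subst id (collapse-shift x d J Δ) (completes I J∈)

  -- Splittings and induction on cut-free proofs

  -- The vocabularies are bounds fixed in advance, so they stay the same as formulas are decomposed,
  -- and `Z` survives the exchange of sides.
  record Split (X Y Z : Pred Var 0ℓ) {n} (Θ Γ Δ : Sequent n) : Set where
    field
      cover      : ∀ {x A} → (x , A) ∈ˡ Θ → ((x , A) ∈ˡ Γ) ⊎ ((x , A) ∈ˡ Δ)
      leftVars   : ∀ {x A} → (x , A) ∈ˡ Γ → var A ⊆ X
      rightVars  : ∀ {x A} → (x , A) ∈ˡ Δ → var A ⊆ Y
      commonVars : X ∩ Y ⊆ Z
  open Split

  module _ {X Y Z : Pred Var 0ℓ} where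
    split-swap : ∀ {n} {Θ Γ Δ : Sequent n} → Split X Y Z Θ Γ Δ → Split Y X Z Θ Δ Γ
    split-swap s = record
      { cover      = Sum.swap ∘ cover s
      ; leftVars   = rightVars s
      ; rightVars  = leftVars s
      ; commonVars = λ (y , x) → commonVars s (x , y)
      }

    split-∷ : ∀ {n} {Θ Γ Δ : Sequent n} {x A} → var A ⊆ X → Split X Y Z Θ Γ Δ →
              Split X Y Z ((x , A) ∷ Θ) ((x , A) ∷ Γ) Δ
    split-∷ A⊆X s = record
      { cover      = λ { (here refl) → inj₁ (here refl) ; (there i) → Sum.map₁ there (cover s i) }
      ; leftVars   = λ { (here refl) → A⊆X ; (there i) → leftVars s i }
      ; rightVars  = rightVars s
      ; commonVars = commonVars s
      }

    split-shift : ∀ {n} {Θ Γ Δ : Sequent n} → Split X Y Z Θ Γ Δ → Split X Y Z (shift Θ) (shift Γ) (shift Δ)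
    split-shift s = record
      { cover      = λ i → let (_ , eq , j) = ∈-shift⁻ i in
          ≡.subst (λ x → ((x , _) ∈ˡ _) ⊎ ((x , _) ∈ˡ _)) (sym eq) (Sum.map ∈-shift⁺ ∈-shift⁺ (cover s j))
      ; leftVars   = λ i → leftVars s (proj₂ (proj₂ (∈-shift⁻ i)))
      ; rightVars  = λ i → rightVars s (proj₂ (proj₂ (∈-shift⁻ i)))
      ; commonVars = commonVars s
      }

  Interpolable : ∀ {n} → Tree n → Sequent n → Set₁
  Interpolable T Θ = ∀ {X Y Z Γ Δ} → Split X Y Z Θ Γ Δ → Interpolant Z T Γ Δ

  -- By the symmetry of interpolants the principal formula may be assumed to lie in Γ.
  principal-left : ∀ {n} {T : Tree n} {Θ x A} → (x , A) ∈ˡ Θ →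
                   (∀ {X Y Z Γ Δ} → (x , A) ∈ˡ Γ → Split X Y Z Θ Γ Δ → Interpolant Z T Γ Δ) →
                   Interpolable T Θ
  principal-left i left s with cover s i
  ... | inj₁ j = left j s
  ... | inj₂ j = interpolant-swap (left j (split-swap s))

  interpolate : ∀ {n} {T : Tree n} {Θ} → Cutfree T Θ → Interpolable T Θ
  interpolate {T = T} (atoms i j) s with cover s i | cover s j
  ... | inj₁ i′ | inj₁ j′ = interpolant-valid λ S → valid-excluded-middle T (∈-++⁺ˡ i′) (∈-++⁺ˡ j′)
  -- An axiom divided between the sides makes its letter common to both, so the atom itself
  -- interpolates.
  ... | inj₁ i′ | inj₂ j′ = interpolant-atoms (commonVars s (leftVars s i′ refl , rightVars s j′ refl)) i′ j′
  ... | inj₂ i′ | inj₁ j′ =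
    interpolant-swap (interpolant-atoms (commonVars s (leftVars s j′ refl , rightVars s i′ refl)) i′ j′)
  ... | inj₂ i′ | inj₂ j′ =
    interpolant-swap (interpolant-valid λ S → valid-excluded-middle T (∈-++⁺ˡ i′) (∈-++⁺ˡ j′))
  interpolate {T = T} (⊤-rule i) = principal-left i λ j s →
    interpolant-valid λ S → valid-theorem T (∈-++⁺ˡ j) (rule₀ ⊤ ⊤ ⊤ ⊤ᵖ refl)
  interpolate (∧-rule i D E) = principal-left i λ j s →
    interpolant-∧ j (interpolate D (split-∷ (leftVars s j ∘ inj₁) s))
                    (interpolate E (split-∷ (leftVars s j ∘ inj₂) s))
  interpolate (∨-rule i D) = principal-left i λ j s →
    interpolant-∨ j (interpolate D (split-∷ (leftVars s j ∘ inj₁) (split-∷ (leftVars s j ∘ inj₂) s)))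
  interpolate (box-rule d i D) = principal-left i λ j s →
    interpolant-box j (interpolate D (split-∷ (leftVars s j ∘ var-box⁻ d _) (split-shift s)))
  interpolate (diamond-rule d i r D) = principal-left i λ j s →
    interpolant-diamond j r (interpolate D (split-∷ (leftVars s j ∘ var-diamond⁻ d _) s))

  -- From clauses at the root to a formula

  root-interpolant : ∀ {Z A B} → Interpolant Z root ((zero , B) ∷ []) ((zero , A) ∷ []) →
                     ∃[ C ] (var C ⊆ Z) × (⊢ A ∨ C) × (⊢ C ⇒ B)
  root-interpolant {Z} {A} {B} I = C , var-C , A∨C , C⇒B
    where
    formula : Sequent 1 → Formula
    formula J = ⋁ (map proj₂ J)

    C : Formula
    C = ⋀ (map formula (clauses I))

    var-C : var C ⊆ Z
    var-C = var-⋀ _ λ i → let (J , J∈ , eq) = ∈-map⁻ formula i in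
      ≡.subst (λ F → var F ⊆ Z) (sym eq)
        (var-⋁ _ λ k → let (_ , m , eq′) = ∈-map⁻ proj₂ k in
          ≡.subst (λ F → var F ⊆ Z) (sym eq′) (vocabulary I J∈ m))

    separate : ∀ J {F} → Valid root (J ++ (zero , F) ∷ []) → ⊢ formula J ∨ F
    separate J {F} D = mp D (⋁-least _ λ i → step (∈-map⁻ proj₂ i))
      where
      step : ∀ {G} → ∃[ a ] (a ∈ˡ J ++ (zero , F) ∷ []) × (G ≡ proj₂ a) → ⊢ G ⇒ formula J ∨ F
      step (_ , i , refl) with ∈-++⁻ J i
      ... | inj₁ j           = ⇒-trans (⋁-upper (∈-map⁺ proj₂ j)) (∨-left F)
      ... | inj₂ (here refl) = ∨-right (formula J)

    A∨C : ⊢ A ∨ C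
    A∨C = rule₁ C A A (p₀ ∨ᵖ p₁) (p₁ ∨ᵖ p₀) refl (⋀-intro A _ λ i →
      let (J , J∈ , eq) = ∈-map⁻ formula i in
      ≡.subst (λ F → ⊢ F ∨ A) (sym eq) (separate J (completes I J∈)))

    C⇒B : ⊢ C ⇒ B
    C⇒B = rule₁ B C C (p₀ ∨ᵖ (n₁ ∨ᵖ ⊥ᵖ)) (n₁ ∨ᵖ p₀) refl
      -- The context `∼ C` turns the entailment into `C ⇒ B`; each clause is a conjunct of `C`.
      (entails I ((zero , ∼ C) ∷ []) λ {J} J∈ → valid-⊆ root (++-⊆-swap _ J)
        (⋀-lower (∈-map⁺ formula J∈)))

corollary16 : (Π : List PathAxiom) (A B : Formula) →
    (A ⇒ B) ∈ Kt⟨ Π ⟩ →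
    ∃[ C ] (var C ⊆ (var A ∩ var B)) × ((A ⇒ C) ∈ Kt⟨ Π ⟩) × ((C ⇒ B) ∈ Kt⟨ Π ⟩)
corollary16 Π A B A⇒B = root-interpolant (interpolate (cutfree-complete (∼ A) B A⇒B) record
  -- `B` goes left and `∼ A` right, since an interpolant implies its left side and is implied by the
  -- negation of its right side.
  { cover      = λ { (here refl) → inj₂ (here refl) ; (there (here refl)) → inj₁ (here refl) }
  ; leftVars   = λ { (here refl) → id }
  ; rightVars  = λ { (here refl) → var-∼ A }
  ; commonVars = λ (b , a) → a , b
  })
  where open Calculus Π
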